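{- If $G$ is a distance preserving graph with $|G|\ge 2$, then the lexicographic product $G[H]$ is distance preserving for any graph $H$.
   Context: All graphs are finite, undirected and simple, with nonempty vertex set; $|G|$ denotes the number of vertices of $G$. The distance $d_G(u,v)$ is the minimum length (number of edges) of a path from $u$ to $v$ in $G$, and $d_G(u,v)=\infty$ if no such path exists. A subgraph $K$ of $G$ is isometric if $d_K(u,v)=d_G(u,v)$ for every pair of vertices $u,v\in V(K)$. A graph $G$ is distance preserving (dp) if it is connected and has an isometric subgraph with exactly $i$ vertices for every $1\le i\le |G|$. The lexicographic product $G[H]$ is the graph with vertex set $V(G)\times V(H)$ and edge set $E(G[H])=\{(u,x)(v,y) : uv\in E(G),\text{ or } (xy\in E(H)\text{ and }u=v)\}$. -}

module Defs where

open import Level using (0ℓ)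
open import Data.Fin.Base using (Fin)
open import Data.Fin.Properties using (*↔×; inj⇒≟)
open import Data.Fin.Subset using (Subset; _∈_; ∣_∣; Nonempty)
open import Data.List.Base using (List; []; _∷_)
open import Data.List.Relation.Unary.Unique.Propositional using (Unique)
open import Data.Nat.Base using (ℕ; zero; suc; _*_; _≤_; NonZero)
open import Data.Nat.Properties using (m*n≢0)
open import Data.Product.Base using (∃; _×_; _,_)
open import Data.Product.Function.NonDependent.Propositional using (_×-↔_)
open import Data.Sum.Base using (_⊎_; inj₁; inj₂)
open import Function.Bundles using (_↔_; Inverse)
open import Function.Properties.Inverse using (↔-sym; ↔-trans; ↔⇒↣)
open import Relation.Binary.Core using (Rel; _⇒_)
open import Relation.Binary.Construct.Closure.ReflexiveTransitive using (Star; ε; _◅_)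
open import Relation.Binary.Definitions using (Decidable; DecidableEquality; Symmetric)
open import Relation.Binary.PropositionalEquality using (_≡_; sym)
open import Relation.Nullary.Construct.Add.Supremum using (_⁺; [_]; ⊤⁺)
open import Relation.Nullary.Decidable using (_×-dec_; _⊎-dec_)
open import Relation.Nullary.Negation using (¬_)

-- Adjacency is decidable because the edge set of a finite graph is a finite
-- set of pairs of vertices.
record Graph : Set₁ where
  infix 4 _~_ _~?_
  field
    Vertex   : Set
    order    : ℕ
    finite   : Vertex ↔ Fin order
    nonempty : NonZero order
    _~_      : Rel Vertex 0ℓ
    _~?_     : Decidable _~_
    ~-sym    : Symmetric _~_
    ~-irrefl : ∀ {u} → ¬ (u ~ u)

  index : Vertex → Fin order
  index = Inverse.to finite

  _≟_ : DecidableEquality Vertex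
  _≟_ = inj⇒≟ (↔⇒↣ finite)

-- A walk along E is an element of Star E; a path is a walk that does not
-- repeat a vertex.
module _ {V : Set} {E : Rel V 0ℓ} where

  vertices : ∀ {u v} → Star E u v → List V
  vertices {u} ε       = u ∷ []
  vertices {u} (_ ◅ w) = u ∷ vertices w

  walkLength : ∀ {u v} → Star E u v → ℕ
  walkLength ε       = zero
  walkLength (_ ◅ w) = suc (walkLength w)

record Path {V : Set} (E : Rel V 0ℓ) (u v : V) : Set where
  field
    walk     : Star E u v
    distinct : Unique (vertices walk)

  length : ℕ
  length = walkLength walk

-- IsDistance E u v d says that d, an element of ℕ ∪ {∞}, is the distance from
-- u to v in the graph with edge relation E.
IsDistance : {V : Set} (E : Rel V 0ℓ) (u v : V) → ℕ ⁺ → Set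
IsDistance E u v [ n ] = (∃ λ (p : Path E u v) → Path.length p ≡ n)
                       × (∀ (p : Path E u v) → n ≤ Path.length p)
IsDistance E u v ⊤⁺    = ¬ Path E u v

-- Subgraphs need not be induced.  The vertex set is recorded as a set of
-- indices under the enumeration of the vertices of G.
record Subgraph (G : Graph) : Set₁ where
  open Graph G
  field
    vertexSet : Subset order
    nonempty  : Nonempty vertexSet
    Edge      : Rel Vertex 0ℓ
    Edge?     : Decidable Edge
    Edge-sym  : Symmetric Edge
    Edge⇒~    : Edge ⇒ _~_
    endpoints : ∀ {u v} → Edge u v → index u ∈ vertexSet × index v ∈ vertexSet

  infix 4 _∈V
  _∈V : Vertex → Set
  v ∈V = index v ∈ vertexSet

  size : ℕ
  size = ∣ vertexSet ∣

-- Since endpoints of edges of K lie in K, a path along Edge that starts at a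
-- vertex of K is a path in K.
Isometric : {G : Graph} → Subgraph G → Set
Isometric {G} K = ∀ u v → u ∈V → v ∈V →
  ∃ λ d → IsDistance Edge u v d × IsDistance _~_ u v d
  where
  open Graph G using (_~_)
  open Subgraph K using (Edge; _∈V)

Connected : Graph → Set
Connected G = ∀ u v → Path (Graph._~_ G) u v

DistancePreserving : Graph → Set₁
DistancePreserving G = Connected G ×
  (∀ i → 1 ≤ i → i ≤ Graph.order G →
    ∃ λ (K : Subgraph G) → Subgraph.size K ≡ i × Isometric K)

_[_]ˡ : Graph → Graph → Graph
G [ H ]ˡ = record
  { Vertex   = G.Vertex × H.Vertex
  ; order    = G.order * H.order
  ; finite   = ↔-trans (G.finite ×-↔ H.finite) (↔-sym *↔×)
  ; nonempty = m*n≢0 G.order H.order {{G.nonempty}} {{H.nonempty}}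
  ; _~_      = λ { (u , x) (v , y) → u G.~ v ⊎ (x H.~ y × u ≡ v) }
  ; _~?_     = λ { (u , x) (v , y) → (u G.~? v) ⊎-dec ((x H.~? y) ×-dec (u G.≟ v)) }
  ; ~-sym    = λ { (inj₁ e)       → inj₁ (G.~-sym e)
                 ; (inj₂ (e , p)) → inj₂ (H.~-sym e , sym p) }
  ; ~-irrefl = λ { (inj₁ e)       → G.~-irrefl e
                 ; (inj₂ (e , _)) → H.~-irrefl e }
  }
  where
  module G = Graph G
  module H = Graph H

{-# OPTIONS --safe #-}

-- Let P be the vertex set of an isometric subgraph of G.  If P has at least two
-- vertices, every set S of vertices of G[H] that projects onto P induces an
-- isometric subgraph: walks between different vertices of P lift to S with any
-- choice of second coordinates, while (u , x) and (u , y) are joined in at most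
-- two steps, through a neighbour of u in P.  The second part is vacuous for a
-- single copy P × {x₀}, which gives the sizes i ≤ |G|; the sets S ⊇ V(G) × {x₀}
-- give all the larger ones.

module Submission where

open import Defs

open import Data.Bool.Base using (_∧_)
open import Data.Bool.Properties using (∧-conicalˡ; ∧-conicalʳ)
open import Data.Fin.Base using (Fin; zero; fromℕ<; punchIn; combine)
open import Data.Fin.Properties using (punchInᵢ≢i)
open import Data.Fin.Subset
  using (Subset; inside; outside; ⊤; ⁅_⁆; _∈_; _⊆_; ∣_∣; Nonempty)
open import Data.Fin.Subset.Properties
  using (_∈?_; x∈⁅x⁆; x∈⁅y⁆⇒x≡y; ∣⊥∣≡0; ∣⊤∣≡n; ∣⁅x⁆∣≡1; ∣p∣≡n⇒p≡⊤; ⊆-refl; s⊆s; ∈⊤)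
open import Data.List.Relation.Unary.All.Properties.Core using (¬Any⇒All¬)
open import Data.List.Relation.Unary.AllPairs.Core using ([]; _∷_)
open import Data.List.Relation.Unary.All using ([])
open import Data.List.Relation.Unary.Any using (here; there)
open import Data.List.Relation.Unary.Unique.Propositional using (Unique)
import Data.List.Membership.DecPropositional as DecMembership
import Data.List.Membership.Propositional as List
open import Data.Nat.Base using (ℕ; suc; _+_; _*_; _≤_; z≤n; s≤s; >-nonZero⁻¹)
import Data.Nat.Properties as ℕ
open import Data.Product.Base using (∃; _×_; _,_; proj₁; proj₂)
open import Data.Sum.Base using (_⊎_; inj₁; inj₂)
open import Data.Vec.Base using ([]; _∷_; _++_; lookup; _⊛*_)
import Data.Vec.Base as Vec
open import Data.Vec.Properties
  using (lookup⇒[]=; []=⇒lookup; lookup-⊛*; lookup-map; map-id; map-const)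
open import Function.Bundles using (Inverse; Injection)
open import Function.Properties.Inverse using (↔⇒↣)
open import Level using (0ℓ)
open import Relation.Binary.Core using (Rel; _⇒_)
open import Relation.Binary.Construct.Closure.ReflexiveTransitive
  using (Star; ε; _◅_; map)
open import Relation.Binary.Definitions using (DecidableEquality)
open import Relation.Binary.PropositionalEquality
  using (_≡_; _≢_; refl; sym; trans; cong; cong₂; cong-app; subst)
open import Relation.Nullary.Construct.Add.Supremum using ([_]; ⊤⁺)
open import Relation.Nullary.Decidable using (yes; no; _×-dec_)
open import Relation.Nullary.Negation using (contradiction)

-- Walks, paths and distances

module _ {V : Set} {E : Rel V 0ℓ} where

  map-walkLength : ∀ {F : Rel V 0ℓ} (f : E ⇒ F) {u v} (w : Star E u v) →
                   walkLength (map f w) ≡ walkLength w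
  map-walkLength f ε       = refl
  map-walkLength f (e ◅ w) = cong suc (map-walkLength f w)

  -- The part of a walk from an occurrence of `t` onwards inherits the distinctness of its vertices.
  suffix : ∀ {u v t} (w : Star E u v) → Unique (vertices w) →
           t List.∈ vertices w →
           ∃ λ (p : Path E t v) → Path.length p ≤ walkLength w
  suffix ε       uq       (here refl) = record { walk = ε ; distinct = uq } , z≤n
  suffix (e ◅ w) uq       (here refl) =
    record { walk = e ◅ w ; distinct = uq } , ℕ.≤-refl
  suffix (e ◅ w) (_ ∷ uq) (there t∈)  =
    let p , p≤w = suffix w uq t∈ in p , ℕ.m≤n⇒m≤1+n p≤w

  module _ (_≟_ : DecidableEquality V) where

    -- The tail is shortened first. If `u` already occurs on the resulting path, the cycle back to
    -- `u` is cut off; otherwise prepending `u` keeps the vertices distinct.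
    shorten : ∀ {u v} (w : Star E u v) →
              ∃ λ (p : Path E u v) → Path.length p ≤ walkLength w
    shorten ε = record { walk = ε ; distinct = [] ∷ [] } , z≤n
    shorten {u} (e ◅ w) with shorten w
    ... | p , p≤w with DecMembership._∈?_ _≟_ u (vertices (Path.walk p))
    ...   | yes u∈p =
      let q , q≤p = suffix (Path.walk p) (Path.distinct p) u∈p
      in q , ℕ.m≤n⇒m≤1+n (ℕ.≤-trans q≤p p≤w)
    ...   | no u∉p  =
      record { walk = e ◅ Path.walk p ; distinct = ¬Any⇒All¬ _ u∉p ∷ Path.distinct p } ,
      s≤s p≤w

    -- Distances are defined by paths, but lifting and projection may repeat vertices; `shorten`
    -- lets walks replace paths in both bounds.
    shortestWalk⇒IsDistance : ∀ {u v n} (w : Star E u v) → walkLength w ≡ n →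
                              (∀ (w′ : Star E u v) → n ≤ walkLength w′) →
                              IsDistance E u v [ n ]
    shortestWalk⇒IsDistance w refl least =
      let p , p≤w = shorten w
      in (p , ℕ.≤-antisym p≤w (least (Path.walk p))) , λ q → least (Path.walk q)

    distance-≤-walk : ∀ {u v n} → IsDistance E u v [ n ] →
                      (w : Star E u v) → n ≤ walkLength w
    distance-≤-walk (_ , least) w =
      let p , p≤w = shorten w in ℕ.≤-trans (least p) p≤w

-- Finite subsets: sizes, interpolation and products

∣p++q∣≡∣p∣+∣q∣ : ∀ {m n} (p : Subset m) (q : Subset n) → ∣ p ++ q ∣ ≡ ∣ p ∣ + ∣ q ∣
∣p++q∣≡∣p∣+∣q∣ []            q = refl
∣p++q∣≡∣p∣+∣q∣ (inside  ∷ p) q = cong suc (∣p++q∣≡∣p∣+∣q∣ p q)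
∣p++q∣≡∣p∣+∣q∣ (outside ∷ p) q = ∣p++q∣≡∣p∣+∣q∣ p q

⊆-interpolate : ∀ {n} (p : Subset n) i → ∣ p ∣ ≤ i → i ≤ n →
                ∃ λ (q : Subset n) → p ⊆ q × ∣ q ∣ ≡ i
⊆-interpolate []            0       _         _         = [] , ⊆-refl , refl
⊆-interpolate (inside ∷ p)  (suc i) (s≤s p≤i) (s≤s i≤n) =
  let q , p⊆q , q≡i = ⊆-interpolate p i p≤i i≤n
  in inside ∷ q , s⊆s p⊆q , cong suc q≡i
⊆-interpolate {suc n} (outside ∷ p) i p≤i i≤n with i ℕ.≤? n
... | yes i≤n′ =
  let q , p⊆q , q≡i = ⊆-interpolate p i p≤i i≤n′
  in outside ∷ q , s⊆s p⊆q , q≡i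
-- Here `i` can only be `suc n`, which forces the full set.
... | no  i≰n  =
  ⊤ , (λ _ → ∈⊤) , trans (∣⊤∣≡n (suc n)) (ℕ.≤-antisym (ℕ.≰⇒> i≰n) i≤n)

infixr 7 _⊗_

-- The Cartesian product, laid out in the order of `combine`, which is also how the vertices of
-- `G [ H ]ˡ` are indexed.
_⊗_ : ∀ {m n} → Subset m → Subset n → Subset (m * n)
p ⊗ q = Vec.map _∧_ p ⊛* q

lookup-⊗ : ∀ {m n} (p : Subset m) (q : Subset n) i j →
           lookup (p ⊗ q) (combine i j) ≡ lookup p i ∧ lookup q j
lookup-⊗ p q i j =
  trans (lookup-⊛* (Vec.map _∧_ p) q i j) (cong-app (lookup-map i _∧_ p) _)

∈-⊗⁺ : ∀ {m n} {p : Subset m} {q : Subset n} {i j} →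
       i ∈ p → j ∈ q → combine i j ∈ p ⊗ q
∈-⊗⁺ {p = p} {q} {i} {j} i∈p j∈q = lookup⇒[]= _ _
  (trans (lookup-⊗ p q i j) (cong₂ _∧_ ([]=⇒lookup i∈p) ([]=⇒lookup j∈q)))

∈-⊗⁻ : ∀ {m n} (p : Subset m) (q : Subset n) {i j} →
       combine i j ∈ p ⊗ q → i ∈ p × j ∈ q
∈-⊗⁻ p q {i} {j} ij∈ =
  let eq = trans (sym (lookup-⊗ p q i j)) ([]=⇒lookup ij∈)
  in lookup⇒[]= i p (∧-conicalˡ _ _ eq) , lookup⇒[]= j q (∧-conicalʳ _ _ eq)

-- Counted row by row: the row of an element of `p` is a copy of `q`, every other row is empty.
∣p⊗q∣≡∣p∣*∣q∣ : ∀ {m n} (p : Subset m) (q : Subset n) → ∣ p ⊗ q ∣ ≡ ∣ p ∣ * ∣ q ∣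
∣p⊗q∣≡∣p∣*∣q∣ []            q = refl
∣p⊗q∣≡∣p∣*∣q∣ (inside  ∷ p) q =
  trans (∣p++q∣≡∣p∣+∣q∣ (Vec.map (inside ∧_) q) (p ⊗ q))
        (cong₂ _+_ (cong ∣_∣ (map-id q)) (∣p⊗q∣≡∣p∣*∣q∣ p q))
∣p⊗q∣≡∣p∣*∣q∣ {n = n} (outside ∷ p) q =
  trans (∣p++q∣≡∣p∣+∣q∣ (Vec.map (outside ∧_) q) (p ⊗ q))
        (cong₂ _+_ (trans (cong ∣_∣ (map-const q outside)) (∣⊥∣≡0 n)) (∣p⊗q∣≡∣p∣*∣q∣ p q))

-- Vertices, neighbours and induced subgraphs

someVertex : (G : Graph) → Graph.Vertex G
someVertex G = Inverse.from finite (fromℕ< (>-nonZero⁻¹ order {{nonempty}}))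
  where open Graph G

index-injective : (G : Graph) → ∀ {u v} → Graph.index G u ≡ Graph.index G v → u ≡ v
index-injective G = Injection.injective (↔⇒↣ (Graph.finite G))

other : ∀ {n} → 2 ≤ n → (i : Fin n) → ∃ λ j → j ≢ i
other (s≤s (s≤s _)) i = punchIn i zero , punchInᵢ≢i i zero

-- A walk from `u` to any other vertex has a first edge.
connected⇒neighbour : (G : Graph) → Connected G → 2 ≤ Graph.order G →
                      ∀ u → ∃ λ v → Graph._~_ G u v
connected⇒neighbour G conn 2≤n u with other 2≤n (Graph.index G u)
... | j , j≢i = firstStep (Path.walk (conn u v)) λ u≡v →
      j≢i (trans (sym (Inverse.strictlyInverseˡ finite j)) (cong index (sym u≡v)))
  where
  open Graph G
  v = Inverse.from finite j

  firstStep : ∀ {v} → Star _~_ u v → u ≢ v → ∃ λ w → u ~ w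
  firstStep ε       u≢u = contradiction refl u≢u
  firstStep (e ◅ _) _   = _ , e

induced : (G : Graph) (S : Subset (Graph.order G)) → Nonempty S → Subgraph G
induced G S S≢∅ = record
  { vertexSet = S
  ; nonempty  = S≢∅
  ; Edge      = λ a b → a ~ b × index a ∈ S × index b ∈ S
  ; Edge?     = λ a b → (a ~? b) ×-dec ((index a ∈? S) ×-dec (index b ∈? S))
  ; Edge-sym  = λ (e , a∈ , b∈) → ~-sym e , b∈ , a∈
  ; Edge⇒~    = proj₁
  ; endpoints = proj₂
  }
  where open Graph G

-- Isometric subgraphs of the lexicographic product

module _ (G H : Graph) where

  private
    module G  = Graph G
    module H  = Graph H
    module GH = Graph (G [ H ]ˡ)

  -- Edges within a copy of `H` collapse to a point. This bounds distances in the product from below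
  -- by distances in `G`.
  project : ∀ {a b} (w : Star GH._~_ a b) →
            ∃ λ (w′ : Star G._~_ (proj₁ a) (proj₁ b)) → walkLength w′ ≤ walkLength w
  project ε = ε , z≤n
  project (inj₁ e ◅ w) = let w′ , w′≤w = project w in e ◅ w′ , s≤s w′≤w
  project (inj₂ (_ , refl) ◅ w) =
    let w′ , w′≤w = project w in w′ , ℕ.m≤n⇒m≤1+n w′≤w

  -- `section` supplies the intermediate vertices of lifted walks; `fibre` supplies the detour
  -- between two vertices over the same `u`, unless they coincide.
  record LiesOver (K : Subgraph G) (S : Subset GH.order) : Set where
    open Subgraph K using (_∈V)
    field
      section : ∀ {u} → u ∈V → ∃ λ x → GH.index (u , x) ∈ S
      base    : ∀ u x → GH.index (u , x) ∈ S → u ∈V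
      fibre   : ∀ {u x y} → GH.index (u , x) ∈ S → GH.index (u , y) ∈ S →
                x ≡ y ⊎ ∃ λ v → u G.~ v × v ∈V

  module Lift {K : Subgraph G} {S : Subset GH.order} (conn : Connected G)
              (K-isometric : Isometric K) (S-over-K : LiesOver K S)
    where

    open LiesOver S-over-K

    private module K = Subgraph K

    nonempty-over : Nonempty S
    nonempty-over =
      let i , i∈K = K.nonempty
          u∈K     = subst (_∈ K.vertexSet) (sym (Inverse.strictlyInverseˡ G.finite i)) i∈K
          _ , ux∈ = section u∈K
      in _ , ux∈

    over : Subgraph (G [ H ]ˡ)
    over = induced (G [ H ]ˡ) S nonempty-over

    private module S = Subgraph over

    -- An edge of `G` joins all second coordinates over its ends. The first edge is split off
    -- because only a nonempty walk leaves both end coordinates free.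
    lift : ∀ {u v t x y} (e : K.Edge u v) (w : Star K.Edge v t) →
           GH.index (u , x) ∈ S → GH.index (t , y) ∈ S →
           ∃ λ (w′ : Star S.Edge (u , x) (t , y)) → walkLength w′ ≡ suc (walkLength w)
    lift e ε       a∈ b∈ = (inj₁ (K.Edge⇒~ e) , a∈ , b∈) ◅ ε , refl
    lift e (f ◅ w) a∈ b∈ =
      let _ , c∈    = section (proj₂ (K.endpoints e))
          w′ , w′≡w = lift f w c∈ b∈
      in (inj₁ (K.Edge⇒~ e) , a∈ , c∈) ◅ w′ , cong suc w′≡w

    -- Every walk in `S` is a walk in the product, so one lower bound serves both distances.
    isDistance-both : ∀ {a b n} (w : Star S.Edge a b) → walkLength w ≡ n →
                      (∀ (w′ : Star GH._~_ a b) → n ≤ walkLength w′) →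
                      IsDistance S.Edge a b [ n ] × IsDistance GH._~_ a b [ n ]
    isDistance-both w w≡n least =
      shortestWalk⇒IsDistance GH._≟_ w w≡n
        (λ w′ → subst (_ ≤_) (map-walkLength proj₁ w′) (least (map proj₁ w′))) ,
      shortestWalk⇒IsDistance GH._≟_ (map proj₁ w) (trans (map-walkLength proj₁ w) w≡n) least

    -- Over different vertices the distance is that of `G`. Over the same vertex it is 0, 1 or 2:
    -- equal, adjacent in `H`, or neither.
    distance-over : ∀ a b → a S.∈V → b S.∈V →
                    ∃ λ n → IsDistance S.Edge a b [ n ] × IsDistance GH._~_ a b [ n ]
    distance-over (u , x) (v , y) a∈ b∈ with u G.≟ v
    ... | no u≢v = between (K-isometric u v (base u x a∈) (base v y b∈))
      where
      liftWalk : (w : Star K.Edge u v) →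
                 ∃ λ (w′ : Star S.Edge (u , x) (v , y)) → walkLength w′ ≡ walkLength w
      liftWalk ε       = contradiction refl u≢v
      liftWalk (e ◅ w) = lift e w a∈ b∈

      between : (∃ λ d → IsDistance K.Edge u v d × IsDistance G._~_ u v d) → _
      between (⊤⁺ , _ , ¬path) = contradiction (conn u v) ¬path
      between ([ n ] , ((p , p≡n) , _) , dist) =
        let w , w≡p = liftWalk (Path.walk p)
        in n , isDistance-both w (trans w≡p p≡n) λ w′ →
             let w″ , w″≤w′ = project w′
             in ℕ.≤-trans (distance-≤-walk G._≟_ dist w″) w″≤w′
    ... | yes refl with x H.≟ y
    ...   | yes refl = 0 , isDistance-both ε refl λ _ → z≤n
    ...   | no x≢y with x H.~? y
    ...     | yes x~y = 1 , isDistance-both ((inj₂ (x~y , refl) , a∈ , b∈) ◅ ε) refl λ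
              { ε       → contradiction refl x≢y
              ; (_ ◅ _) → s≤s z≤n }
    ...     | no x≁y with fibre a∈ b∈
    ...       | inj₁ x≡y = contradiction x≡y x≢y
    ...       | inj₂ (_ , u~w , w∈K) =
      let _ , c∈ = section w∈K
      in 2 , isDistance-both
           ((inj₁ u~w , a∈ , c∈) ◅ (inj₁ (G.~-sym u~w) , c∈ , b∈) ◅ ε) refl λ
           -- A single step would be a loop of `G` at `u` or an edge of `H` from `x` to `y`.
           { ε                    → contradiction refl x≢y
           ; (inj₁ u~u ◅ ε)       → contradiction u~u G.~-irrefl
           ; (inj₂ (x~y , _) ◅ ε) → contradiction x~y x≁y
           ; (_ ◅ _ ◅ _)          → s≤s (s≤s z≤n) }

    isometric-over : Isometric over
    isometric-over a b a∈ b∈ = let n , dist = distance-over a b a∈ b∈ in [ n ] , dist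

-- Subgraphs of every size in the product

corollary3p3 : (G H : Graph) → DistancePreserving G → 2 ≤ Graph.order G → DistancePreserving (G [ H ]ˡ)
corollary3p3 G H (conn , sub) 2≤n = connected , subgraph
  where
  module G  = Graph G
  module H  = Graph H
  module GH = Graph (G [ H ]ˡ)

  x₀ = someVertex H

  copy : Subgraph G → Subset GH.order
  copy K = Subgraph.vertexSet K ⊗ ⁅ H.index x₀ ⁆

  ∣copy∣ : ∀ K → ∣ copy K ∣ ≡ Subgraph.size K
  ∣copy∣ K = trans (∣p⊗q∣≡∣p∣*∣q∣ (Subgraph.vertexSet K) _)
    (trans (cong (Subgraph.size K *_) (∣⁅x⁆∣≡1 (H.index x₀))) (ℕ.*-identityʳ _))

  ∈-copy⁺ : ∀ K {u} → Subgraph._∈V K u → GH.index (u , x₀) ∈ copy K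
  ∈-copy⁺ K u∈K = ∈-⊗⁺ u∈K (x∈⁅x⁆ _)

  ∈-copy⁻ : ∀ K u x → GH.index (u , x) ∈ copy K → Subgraph._∈V K u × x ≡ x₀
  ∈-copy⁻ K u x a∈ =
    let u∈K , x∈ = ∈-⊗⁻ (Subgraph.vertexSet K) _ a∈
    in u∈K , index-injective H (x∈⁅y⁆⇒x≡y _ x∈)

  -- Each fibre is the single vertex over `x₀`, so this also covers a `K` with one vertex.
  copy-over : ∀ K → LiesOver G H K (copy K)
  copy-over K = record
    { section = λ u∈K → x₀ , ∈-copy⁺ K u∈K
    ; base    = λ u x a∈ → proj₁ (∈-copy⁻ K u x a∈)
    ; fibre   = λ {u} {x} {y} a∈ b∈ →
        inj₁ (trans (proj₂ (∈-copy⁻ K u x a∈)) (sym (proj₂ (∈-copy⁻ K u y b∈))))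
    }

  -- The hypothesis at size `G.order` yields an isometric subgraph that contains every vertex of
  -- `G`.
  whole : ∃ λ (V : Subgraph G) → Subgraph.size V ≡ G.order × Isometric V
  whole = sub G.order (ℕ.≤-trans (s≤s z≤n) 2≤n) ℕ.≤-refl

  V : Subgraph G
  V = proj₁ whole

  ∣V∣≡n : Subgraph.size V ≡ G.order
  ∣V∣≡n = proj₁ (proj₂ whole)

  V-isometric : Isometric V
  V-isometric = proj₂ (proj₂ whole)

  ∈V : ∀ u → Subgraph._∈V V u
  ∈V u = subst (G.index u ∈_) (sym (∣p∣≡n⇒p≡⊤ ∣V∣≡n)) ∈⊤

  -- The copy inside `S` meets every fibre, and the detour exists because each vertex of `G` has a
  -- neighbour, which lies in `V`.
  superset-over : ∀ {S} → copy V ⊆ S → LiesOver G H V S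
  superset-over copy⊆S = record
    { section = λ u∈V → x₀ , copy⊆S (∈-copy⁺ V u∈V)
    ; base    = λ u _ _ → ∈V u
    ; fibre   = λ {u} _ _ →
        let v , u~v = connected⇒neighbour G conn 2≤n u in inj₂ (v , u~v , ∈V v)
    }

  connected : Connected (G [ H ]ˡ)
  connected a b =
    -- With `S` the full vertex set, a finite distance carries a path that attains it.
    let open Lift G H conn V-isometric (superset-over {⊤} λ _ → ∈⊤)
        _ , _ , (p , _) , _ = distance-over a b ∈⊤ ∈⊤
    in p

  subgraph : ∀ i → 1 ≤ i → i ≤ GH.order →
             ∃ λ (K : Subgraph (G [ H ]ˡ)) → Subgraph.size K ≡ i × Isometric K
  subgraph i 1≤i i≤nm with ℕ.≤-total i G.order
  ... | inj₁ i≤n =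
    let K , ∣K∣≡i , K-isometric = sub i 1≤i i≤n
        open Lift G H conn K-isometric (copy-over K)
    in over , trans (∣copy∣ K) ∣K∣≡i , isometric-over
  ... | inj₂ n≤i =
    let ∣copy∣≤i = ℕ.≤-trans (ℕ.≤-reflexive (trans (∣copy∣ V) ∣V∣≡n)) n≤i
        _ , copy⊆S , ∣S∣≡i = ⊆-interpolate (copy V) i ∣copy∣≤i i≤nm
        open Lift G H conn V-isometric (superset-over copy⊆S)
    in over , ∣S∣≡i , isometric-over
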